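{- There is a family of total Boolean functions with $\mathrm{C}(f)=\Omega(\mathrm{s}(f)^{2.22})$.
   Context: Functions are total Boolean functions $f:\{0,1\}^n\to\{0,1\}$, with $n$ varying within the family. A certificate for $x\in\{0,1\}^n$ is a partial assignment $p\in\{0,1,*\}^n$ consistent with $x$ such that $f$ is constant on all inputs consistent with $p$; its size is its number of non-$*$ entries. $\mathrm{C}_x(f)$ is the minimum size of a certificate for $x$ and $\mathrm{C}(f)=\max_x\mathrm{C}_x(f)$. The sensitivity $\mathrm{s}(f)$ is the maximum over $x$ of the number of $i\in[n]$ with $f(x^i)\neq f(x)$, where $x^i$ is $x$ with bit $i$ flipped. Convention: "a family of functions with $A(f)=\Omega(B(f)^a)$" means an infinite sequence of non-constant Boolean functions along which $B(f)\to\infty$, together with a constant $c>0$ such that $A(f)\ge c\,B(f)^a$ for every $f$ in the sequence. -}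

module Defs where

open import Algebra.Definitions.RawSemiring using () renaming (_^_ to pow)
open import Data.Bool using (Bool; true; false; not)
open import Data.Bool.Properties using () renaming (_≟_ to _≟ᵇ_)
open import Data.Fin using (Fin)
open import Data.Integer using (+_)
open import Data.List as List using (List; []; _∷_; cartesianProductWith; filter)
open import Data.List.Extrema.Nat using (max; min)
open import Data.List.Membership.Propositional using (_∈_)
open import Data.List.Membership.Propositional.Properties
  using (∈-cartesianProductWith⁺)
open import Data.List.Relation.Unary.All as All using (all?)
open import Data.List.Relation.Unary.Any using (here; there)
open import Data.Maybe using (Maybe; just; nothing; Is-just)
open import Data.Maybe.Relation.Unary.All as MaybeAll using ()
open import Data.Maybe.Relation.Unary.Any as MaybeAny using ()
open import Data.Nat as ℕ using (ℕ; zero; suc; NonZero)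
open import Data.Product using (_×_; ∃-syntax; Σ-syntax)
open import Data.Rational as ℚ using (ℚ; +-*-rawSemiring)
open import Data.Unit using (tt)
open import Data.Vec as Vec using (Vec; []; _∷_; allFin; count; _[_]%=_)
open import Data.Vec.Relation.Binary.Pointwise.Inductive as Pointwise
  using (Pointwise)
open import Relation.Binary.PropositionalEquality using (_≡_; _≢_; refl)
open import Relation.Nullary using (Dec; yes)
open import Relation.Nullary.Decidable using (map′; ¬?; _×-dec_; _→-dec_)
open import Relation.Unary using (Decidable)

vecs : ∀ {A : Set} → List A → ∀ n → List (Vec A n)
vecs as zero    = [] ∷ []
vecs as (suc n) = cartesianProductWith _∷_ as (vecs as n)

∈-vecs : ∀ {A : Set} {as : List A} → (∀ a → a ∈ as) →
         ∀ {n} (v : Vec A n) → v ∈ vecs as n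
∈-vecs all []      = here refl
∈-vecs all (a ∷ v) = ∈-cartesianProductWith⁺ _∷_ (all a) (∈-vecs all v)

bits : List Bool
bits = false ∷ true ∷ []

∈-bits : ∀ b → b ∈ bits
∈-bits false = here refl
∈-bits true  = there (here refl)

inputs : ∀ n → List (Vec Bool n)
inputs = vecs bits

∀-input? : ∀ {n} {P : Vec Bool n → Set} → Decidable P → Dec (∀ x → P x)
∀-input? {n} P? = map′
  (λ ps x → All.lookup ps (∈-vecs ∈-bits x))
  (λ p → All.tabulate (λ {x} _ → p x))
  (all? P? (inputs n))

BoolFun : ℕ → Set
BoolFun n = Vec Bool n → Bool

NonConstant : ∀ {n} → BoolFun n → Set
NonConstant f = ∃[ x ] ∃[ y ] f x ≢ f y

flip : ∀ {n} → Vec Bool n → Fin n → Vec Bool n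
flip x i = x [ i ]%= not

sensitivityAt : ∀ {n} → BoolFun n → Vec Bool n → ℕ
sensitivityAt {n} f x = count (λ i → ¬? (f (flip x i) ≟ᵇ f x)) (allFin n)

sensitivity : ∀ {n} → BoolFun n → ℕ
sensitivity {n} f = max 0 (List.map (sensitivityAt f) (inputs n))

-- `nothing` plays the role of the symbol *.
PartialAssignment : ℕ → Set
PartialAssignment n = Vec (Maybe Bool) n

partialAssignments : ∀ n → List (PartialAssignment n)
partialAssignments = vecs (nothing ∷ List.map just bits)

size : ∀ {n} → PartialAssignment n → ℕ
size = count {P = Is-just} (MaybeAny.dec (λ _ → yes tt))

Consistent : ∀ {n} → PartialAssignment n → Vec Bool n → Set
Consistent = Pointwise (λ m b → MaybeAll.All (_≡ b) m)

consistent? : ∀ {n} (p : PartialAssignment n) x → Dec (Consistent p x)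
consistent? = Pointwise.decidable (λ m b → MaybeAll.dec (_≟ᵇ b) m)

IsCertificate : ∀ {n} → BoolFun n → Vec Bool n → PartialAssignment n → Set
IsCertificate f x p =
  Consistent p x × (∀ y z → Consistent p y → Consistent p z → f y ≡ f z)

isCertificate? : ∀ {n} (f : BoolFun n) x → Decidable (IsCertificate f x)
isCertificate? f x p = consistent? p x ×-dec
  ∀-input? (λ y → ∀-input? (λ z →
    consistent? p y →-dec (consistent? p z →-dec (f y ≟ᵇ f z))))

-- The starting value n of the minimum is harmless: it is attained, since
-- the total assignment Vec.map just x is a certificate for x of size n.
certificateComplexityAt : ∀ {n} → BoolFun n → Vec Bool n → ℕ
certificateComplexityAt {n} f x =
  min n (List.map size (filter (isCertificate? f x) (partialAssignments n)))

certificateComplexity : ∀ {n} → BoolFun n → ℕ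
certificateComplexity {n} f = max 0 (List.map (certificateComplexityAt f) (inputs n))

TendsToInfinity : (ℕ → ℕ) → Set
TendsToInfinity u = ∀ M → ∃[ K ] ∀ k → K ℕ.≤ k → M ℕ.≤ u k

fromℕ : ℕ → ℚ
fromℕ m = + m ℚ./ 1

-- For c > 0, this is the real inequality  a ≥ c · b^(p/q)  with both
-- (nonnegative) sides raised to the power q.
_≥_·_^[_/_] : ℕ → ℚ → ℕ → (p q : ℕ) → .{{_ : NonZero q}} → Set
a ≥ c · b ^[ p / q ] =
  pow +-*-rawSemiring c q ℚ.* fromℕ (b ℕ.^ p) ℚ.≤ fromℕ (a ℕ.^ q)

-- A family of functions with A(f) = Ω(B(f)^(p/q)).  Taking the constant c
-- to be rational loses nothing: below every positive real there is a
-- positive rational.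
OmegaFamily : (A B : ∀ {n} → BoolFun n → ℕ) (p q : ℕ) → .{{_ : NonZero q}} → Set
OmegaFamily A B p q =
  Σ[ n ∈ (ℕ → ℕ) ] Σ[ f ∈ (∀ k → BoolFun (n k)) ]
    (∀ k → NonConstant (f k))
    × TendsToInfinity (λ k → B (f k))
    × ∃[ c ] ℚ.0ℚ ℚ.< c × (∀ k → A (f k) ≥ c · B (f k) ^[ p / q ])

{-# OPTIONS --safe #-}
module Submission where

-- Consider an N × N matrix of gadgets, N = m², each holding one bit w and m
-- bits k.  A gadget is 1 if w = 1, or, more expensively, if all of k is 1; it
-- is 0 if w = 0 and some bit of k is 0.  A 1-certificate proves all gadgets of
-- one row to be 1, paying the expensive price at most m times; a 0-certificate
-- proves a gadget in every row to be 0.  Both have size 2N.  On the input with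
-- all w = 0 and all k = 1 neither exists, and it costs N m = N^(3/2) bits to
-- rule out either of them: a row with at most m of its bits w read still admits
-- a 1-certificate, and one unread bit of k in each row admits a 0-certificate.
-- Cheat sheets turn this into an unambiguous DNF of width O(N log² N) whose
-- falsity on some input costs N^(3/2) to certify.  The OR of T desensitised
-- copies, with T at least the width, has sensitivity O(T) and certificate
-- complexity at least T N^(3/2), which is s^(5/2) up to logarithmic factors.

open import Defs
open import Algebra.Bundles using (CommutativeMonoid)
open import Algebra.Definitions.RawSemiring using () renaming (_^_ to pow)
open import Algebra.Properties.CommutativeSemigroup using (interchange)
open import Data.Bool using (Bool; true; false; not; if_then_else_)
open import Data.Bool.Properties using (not-¬; not-involutive) renaming (_≟_ to _≟ᵇ_)
open import Data.Empty using (⊥; ⊥-elim)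
open import Data.Fin
  using (Fin; zero; suc; fromℕ<; combine; remQuot; quotient; remainder; finToFun; funToFin; inject≤)
open import Data.Fin.Properties
  using (_≟_; any?; all?; suc-injective; inject≤-injective; injective⇒≤; 2↔Bool; +↔⊎; *↔×;
         combine-remQuot; remQuot-combine; funToFin-finToFin; finToFun-funToFin; inj⇒≟)
open import Data.Integer as ℤ using (+_)
import Data.Integer.Properties as ℤ
open import Data.List as List using ()
open import Data.List.Extrema.Nat using (max≤v⁺; v≤max⁺; v≤min⁺)
open import Data.List.Membership.Propositional using (lose)
open import Data.List.Membership.Propositional.Properties using (∈-map⁺)
import Data.List.Relation.Unary.All as All
import Data.List.Relation.Unary.All.Properties as All
open import Data.Maybe using (just; Is-just)
import Data.Maybe.Relation.Unary.All as MaybeAll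
import Data.Maybe.Relation.Unary.Any as MaybeAny
open import Data.Nat using (ℕ; zero; suc; _+_; _*_; _^_; _≤_; z≤n; NonZero; >-nonZero)
open import Data.Nat.Properties
  using (≤-refl; ≤-reflexive; ≤-trans; +-mono-≤; *-mono-≤; *-monoˡ-≤; *-monoʳ-≤; *-comm;
         ^-monoˡ-≤; ^-monoʳ-≤; ^-*-assoc; ^-distribˡ-+-*; m^n>0; m≤m+n; m≤n+m; m≤m*n; m≤n*m;
         module ≤-Reasoning)
open import Data.Nat.Tactic.RingSolver using (solve-∀)
open import Data.Product using (_×_; _,_; ∃; proj₁; proj₂)
open import Data.Product.Function.NonDependent.Propositional using (_×-↔_)
open import Data.Product.Properties using (,-injective)
open import Data.Rational as ℚ using (+-*-rawSemiring; 1ℚ)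
import Data.Rational.Properties as ℚ
open import Data.Rational.Unnormalised as ℚᵘ using (mkℚᵘ; *≡*; *≤*)
import Data.Rational.Unnormalised.Properties as ℚᵘ
open import Data.Sum using (_⊎_; inj₁; inj₂; swap)
open import Data.Sum.Function.Propositional using (_⊎-↔_)
open import Data.Unit using (tt)
open import Data.Vec as Vec using (Vec; []; _∷_; lookup; tabulate; allFin; count)
open import Data.Vec.Properties
  using (count≤n; lookup∘tabulate; lookup-allFin; lookup∘updateAt; lookup∘updateAt′)
open import Data.Vec.Relation.Binary.Pointwise.Inductive using ([]; _∷_)
open import Function using (_∘_; id)
open import Function.Bundles using (_↔_; Inverse; Injection)
open import Function.Definitions using (Injective)
open import Function.Properties.Inverse using (↔-refl; ↔-sym; ↔-trans; ↔⇒↣)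
open import Relation.Binary.Definitions using (DecidableEquality)
open import Relation.Binary.PropositionalEquality
  using (_≡_; _≢_; refl; sym; trans; cong; cong₂; subst; subst₂; module ≡-Reasoning)
import Relation.Binary.Reasoning.Setoid as SetoidReasoning
open import Relation.Nullary using (Dec; yes; no; ¬_; contradiction)
open import Relation.Nullary.Decidable
  using (does; map′; ¬?; _×-dec_; _→-dec_; decidable-stable; dec-true; dec-false)
open import Relation.Unary using (Decidable)

-- Lower and upper bounds on the size of a set.

record Large (K : ℕ) {P : Set} (D : P → Set) : Set where
  field
    at        : Fin K → P
    injective : Injective _≡_ _≡_ at
    inside    : ∀ k → D (at k)

-- An upper bound on the size of `D`: `by` may repeat elements and may leave `D`, so no exact count
-- is required.
record Covered (B : ℕ) {P : Set} (D : P → Set) : Set where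
  field
    by     : Fin B → P
    covers : ∀ {p} → D p → ∃ λ j → by j ≡ p

↔-injective : {A B : Set} (e : A ↔ B) → Injective _≡_ _≡_ (Inverse.to e)
↔-injective e = Injection.injective (↔⇒↣ e)

large-via : ∀ {K} {Y P : Set} {D : P → Set} → Fin K ↔ Y → (f : Y → P) →
            Injective _≡_ _≡_ f → (∀ y → D (f y)) → Large K D
large-via e f inj f∈D = record
  { at        = f ∘ Inverse.to e
  ; injective = ↔-injective e ∘ inj
  ; inside    = f∈D ∘ Inverse.to e
  }

covered-via : ∀ {B} {Y P : Set} {D : P → Set} → Fin B ↔ Y → (f : Y → P) →
              (∀ {p} → D p → ∃ λ y → f y ≡ p) → Covered B D
covered-via e f f-covers = record
  { by     = f ∘ Inverse.to e
  ; covers = λ d → let y , fy≡p = f-covers d in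
      Inverse.from e y , trans (cong f (Inverse.strictlyInverseˡ e y)) fy≡p
  }

large-map : ∀ {K} {P P′ : Set} {D : P → Set} {D′ : P′ → Set} (f : P → P′) →
            Injective _≡_ _≡_ f → (∀ {p} → D p → D′ (f p)) → Large K D → Large K D′
large-map f inj D⊆ L = record
  { at = f ∘ at ; injective = injective ∘ inj ; inside = D⊆ ∘ inside }
  where open Large L

large-× : ∀ {T K} {P : Set} {D : Fin T × P → Set} →
          (∀ a → Large K (λ p → D (a , p))) → Large (T * K) D
large-× {D = D} L = large-via *↔× f f-injective λ (a , k) → Large.inside (L a) k
  where
  f : _ → _
  f (a , k) = a , Large.at (L a) k
  f-injective : Injective _≡_ _≡_ f
  f-injective {a , k} {a′ , k′} eq with ,-injective eq
  ... | refl , eq′ = cong (a ,_) (Large.injective (L a) eq′)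

large-≤ : ∀ {K K′} {P : Set} {D : P → Set} → K ≤ K′ → Large K′ D → Large K D
large-≤ K≤K′ L = record
  { at        = λ k → at (inject≤ k K≤K′)
  ; injective = inject≤-injective K≤K′ K≤K′ _ _ ∘ injective
  ; inside    = λ k → inside (inject≤ k K≤K′)
  }
  where open Large L

-- `ρ` may use the proof of membership, since an index into a cover is extracted from such a proof.
large-bound : ∀ {K B} {P : Set} {D : P → Set} → Large K D →
              (ρ : ∀ {p} → D p → Fin B) → (∀ {p q} (d : D p) (e : D q) → ρ d ≡ ρ e → p ≡ q) →
              K ≤ B
large-bound L ρ ρ-injective =
  injective⇒≤ {f = λ k → ρ (inside k)} (λ eq → injective (ρ-injective (inside _) (inside _) eq))
  where open Large L

large≤covered : ∀ {K B} {P : Set} {D : P → Set} → Large K D → Covered B D → K ≤ B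
large≤covered L C = large-bound L (proj₁ ∘ covers) λ d e eq →
  trans (sym (proj₂ (covers d))) (trans (cong by eq) (proj₂ (covers e)))
  where open Covered C

-- Elements are removed from `D` one at a time. Either this succeeds `m` times, or `D` runs out and
-- the removed elements, padded with `i₀`, list all of it.
large-or-covered : ∀ {n} m (D : Fin n → Set) → Decidable D → Fin n → Large m D ⊎ Covered m D
large-or-covered zero    D D? i₀ = inj₁ record { at = λ () ; injective = λ { {()} } ; inside = λ () }
large-or-covered {n} (suc m) D D? i₀ with any? D?
... | no ¬∃ = inj₂ record { by = λ _ → i₀ ; covers = λ d → contradiction (_ , d) ¬∃ }
... | yes (i , i∈D) with large-or-covered m (λ j → D j × j ≢ i) (λ j → D? j ×-dec ¬? (j ≟ i)) i₀
... | inj₁ L = inj₁ record { at = at′ ; injective = injective′ ; inside = inside′ }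
  where
  open Large L
  at′ : Fin (suc m) → Fin n
  at′ zero    = i
  at′ (suc k) = at k
  injective′ : Injective _≡_ _≡_ at′
  injective′ {zero}  {zero}  _  = refl
  injective′ {zero}  {suc k} eq = contradiction (sym eq) (proj₂ (inside k))
  injective′ {suc k} {zero}  eq = contradiction eq (proj₂ (inside k))
  injective′ {suc k} {suc l} eq = cong suc (injective eq)
  inside′ : ∀ k → D (at′ k)
  inside′ zero    = i∈D
  inside′ (suc k) = proj₁ (inside k)
... | inj₂ C = inj₂ record { by = by′ ; covers = covers′ }
  where
  open Covered C
  by′ : Fin (suc m) → Fin n
  by′ zero    = i
  by′ (suc k) = by k
  covers′ : ∀ {j} → D j → ∃ λ k → by′ k ≡ j
  covers′ {j} d with j ≟ i
  ... | yes j≡i = zero , sym j≡i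
  ... | no  j≢i = let k , eq = covers (d , j≢i) in suc k , eq

module _ {A : Set} {P : A → Set} (P? : Decidable P) where

  count-large : ∀ {n} (v : Vec A n) → Large (count P? v) (λ i → P (lookup v i))
  count-large [] = record { at = λ () ; injective = λ { {()} } ; inside = λ () }
  count-large (x ∷ v) with P? x | count-large v
  ... | no _  | L = record { at = suc ∘ at ; injective = injective ∘ suc-injective ; inside = inside }
    where open Large L
  ... | yes p | L = record { at = at′ ; injective = injective′ ; inside = inside′ }
    where
    open Large L
    at′ : Fin (suc (count P? v)) → Fin _
    at′ zero    = zero
    at′ (suc k) = suc (at k)
    injective′ : Injective _≡_ _≡_ at′
    injective′ {zero}  {zero}  _  = refl
    injective′ {suc k} {suc l} eq = cong suc (injective (suc-injective eq))
    inside′ : ∀ k → P (lookup (x ∷ v) (at′ k))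
    inside′ zero    = p
    inside′ (suc k) = inside k

  count-covered : ∀ {n} (v : Vec A n) → Covered (count P? v) (λ i → P (lookup v i))
  count-covered [] = record { by = λ () ; covers = λ { {()} } }
  count-covered (x ∷ v) with P? x | count-covered v
  ... | no ¬p | C = record { by = suc ∘ by ; covers = covers′ }
    where
    open Covered C
    covers′ : ∀ {i} → P (lookup (x ∷ v) i) → ∃ λ k → suc (by k) ≡ i
    covers′ {zero}  p = contradiction p ¬p
    covers′ {suc i} p = let k , eq = covers p in k , cong suc eq
  ... | yes _ | C = record { by = by′ ; covers = covers′ }
    where
    open Covered C
    by′ : Fin (suc (count P? v)) → Fin _
    by′ zero    = zero
    by′ (suc k) = suc (by k)
    covers′ : ∀ {i} → P (lookup (x ∷ v) i) → ∃ λ k → by′ k ≡ i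
    covers′ {zero}  p = zero , refl
    covers′ {suc i} p = let k , eq = covers p in suc k , cong suc eq

-- Finite types and finite choice.

record Finite (A : Set) : Set where
  field
    {card} : ℕ
    enum   : Fin card ↔ A

  index : A → Fin card
  index = Inverse.from enum

  element : Fin card → A
  element = Inverse.to enum

  element-index : ∀ a → element (index a) ≡ a
  element-index = Inverse.strictlyInverseˡ enum

  index-element : ∀ i → index (element i) ≡ i
  index-element = Inverse.strictlyInverseʳ enum

  ∀? : {P : A → Set} → Decidable P → Dec (∀ a → P a)
  ∀? {P} P? = map′ (λ h a → subst P (element-index a) (h (index a))) (λ h i → h (element i))
                   (all? (P? ∘ element))

  infix 4 _≟ᶠ_
  _≟ᶠ_ : DecidableEquality A
  _≟ᶠ_ = inj⇒≟ (↔⇒↣ (↔-sym enum))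

  index-injective : Injective _≡_ _≡_ index
  index-injective = ↔-injective (↔-sym enum)

  element-injective : Injective _≡_ _≡_ element
  element-injective = ↔-injective enum

finite-Fin : ∀ n → Finite (Fin n)
finite-Fin n = record { enum = ↔-refl }

_×-finite_ : {A B : Set} → Finite A → Finite B → Finite (A × B)
FA ×-finite FB = record { enum = ↔-trans *↔× (Finite.enum FA ×-↔ Finite.enum FB) }

_⊎-finite_ : {A B : Set} → Finite A → Finite B → Finite (A ⊎ B)
FA ⊎-finite FB = record { enum = ↔-trans +↔⊎ (Finite.enum FA ⊎-↔ Finite.enum FB) }

-- Stands in for excluded middle in the proofs of hardness below.
search : ∀ {n} {A B : Fin n → Set} → (∀ i → A i ⊎ B i) → ∃ A ⊎ (∀ i → B i)
search {zero}  h = inj₂ λ ()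
search {suc n} h with h zero | search (h ∘ suc)
... | inj₁ a | _            = inj₁ (zero , a)
... | inj₂ _ | inj₁ (i , a) = inj₁ (suc i , a)
... | inj₂ b | inj₂ bs      = inj₂ λ { zero → b ; (suc i) → bs i }

-- A partial function with an input that is hard for both values.

-- A partial function given by M certificates for each of its two values.  The
-- certificate c for v demands that every position in Dom v c has value v.
-- On the undecided input, refuting either value is expensive.
record PartialFunction (M B K : ℕ) : Set₁ where
  field
    {Pos}     : Set
    finite    : Finite Pos
    Dom       : Bool → Fin M → Pos → Set
    Dom?      : ∀ v c → Decidable (Dom v c)
    meet      : ∀ c c′ → ∃ λ q → Dom false c q × Dom true c′ q
    covered   : ∀ v c → Covered B (Dom v c)
    undecided : Pos → Bool
    hard      : ∀ v (D : Pos → Set) → Decidable D →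
                Large K D ⊎ ∃ λ c → ∀ {q} → D q → Dom v c q → undecided q ≡ v

  -- Certificates for different values would demand both values at the position where they meet.
  same-value : ∀ {v v′ c c′} {x : Pos → Bool} →
               (∀ {q} → Dom v c q → x q ≡ v) → (∀ {q} → Dom v′ c′ q → x q ≡ v′) → v ≡ v′
  same-value {false} {false} h h′ = refl
  same-value {true}  {true}  h h′ = refl
  same-value {false} {true}  h h′ = let _ , d , d′ = meet _ _ in trans (sym (h d)) (h′ d′)
  same-value {true}  {false} h h′ = let _ , d′ , d = meet _ _ in trans (sym (h d)) (h′ d′)

-- Position (s , i , zero) is the bit w of the gadget in row s and column i, and
-- (s , i , suc k) its k-th other bit.  A code is read as the row and the
-- exceptional columns of a 1-certificate as well as the choice of a column and
-- a bit for every row, which make up a 0-certificate.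
module Base (m : ℕ) (o : Fin m) where

  N = m * m

  -- Exceptions may repeat, so every number below this product is a valid code: the first factor
  -- counts a row with m exceptions, the second a column and a bit for each row.
  Codes : ℕ
  Codes = N ^ suc m * (N * m) ^ N

  private
    head : Fin Codes → Fin (suc m) → Fin N
    head c = finToFun (quotient {N ^ suc m} ((N * m) ^ N) c)

    row : Fin Codes → Fin N
    row c = head c zero

    exception : Fin Codes → Fin m → Fin N
    exception c a = head c (suc a)

    choice : Fin Codes → Fin N → Fin N × Fin m
    choice c s = remQuot {N} m (finToFun (remainder {N ^ suc m} ((N * m) ^ N) c) s)

    column : Fin Codes → Fin N → Fin N
    column c s = proj₁ (choice c s)

    bitAt : Fin Codes → Fin N → Fin m
    bitAt c s = proj₂ (choice c s)

    Position : Set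
    Position = Fin N × Fin N × Fin (suc m)

    Dom : Bool → Fin Codes → Position → Set
    Dom false c (s , i , zero)  = i ≡ column c s
    Dom false c (s , i , suc k) = i ≡ column c s × k ≡ bitAt c s
    Dom true  c (s , i , zero)  = s ≡ row c × ¬ (∃ λ a → exception c a ≡ i)
    Dom true  c (s , i , suc k) = s ≡ row c × ∃ λ a → exception c a ≡ i

    Dom? : ∀ v c → Decidable (Dom v c)
    Dom? false c (s , i , zero)  = i ≟ _
    Dom? false c (s , i , suc k) = i ≟ _ ×-dec k ≟ _
    Dom? true  c (s , i , zero)  = s ≟ _ ×-dec ¬? (any? λ a → exception c a ≟ i)
    Dom? true  c (s , i , suc k) = s ≟ _ ×-dec any? (λ a → exception c a ≟ i)

    -- In the row of the 1-certificate both read the gadget chosen by the 0-certificate: they share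
    -- a bit k if its column is exceptional, and w otherwise.
    meet : ∀ c c′ → ∃ λ q → Dom false c q × Dom true c′ q
    meet c c′ with any? (λ a → exception c′ a ≟ column c (row c′))
    ... | yes e = (row c′ , _ , suc _) , (refl , refl) , (refl , e)
    ... | no ¬e = (row c′ , _ , zero)  , refl , (refl , ¬e)

    covered : ∀ v c → Covered (N + N) (Dom v c)
    covered false c = covered-via +↔⊎ f f-covers
      where
      f : Fin N ⊎ Fin N → Position
      f (inj₁ s) = s , column c s , zero
      f (inj₂ s) = s , column c s , suc (bitAt c s)
      f-covers : ∀ {p} → Dom false c p → ∃ λ y → f y ≡ p
      f-covers {s , i , zero}  refl          = inj₁ s , refl
      f-covers {s , i , suc k} (refl , refl) = inj₂ s , refl
    -- As `N` is `m * m`, the m bits k of m exceptional gadgets fill the second summand. The first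
    -- lists the bits w of all columns, exceptional ones included.
    covered true c = covered-via (↔-trans +↔⊎ (↔-refl ⊎-↔ *↔×)) f f-covers
      where
      f : Fin N ⊎ (Fin m × Fin m) → Position
      f (inj₁ i)       = row c , i , zero
      f (inj₂ (a , k)) = row c , exception c a , suc k
      f-covers : ∀ {p} → Dom true c p → ∃ λ y → f y ≡ p
      f-covers {s , i , zero}  (refl , _)        = inj₁ i , refl
      f-covers {s , i , suc k} (refl , a , refl) = inj₂ (a , k) , refl

    undecided : Position → Bool
    undecided (s , i , zero)  = false
    undecided (s , i , suc k) = true

    -- If at most m bits w of some row lie in `D`, their columns are made exceptional; the
    -- certificate then meets `D` only in bits k, which are 1. Otherwise each of the N rows
    -- contributes m bits w.
    hard-true : (D : Position → Set) → Decidable D →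
                Large (N * m) D ⊎ ∃ λ c → ∀ {q} → D q → Dom true c q → undecided q ≡ true
    hard-true D D? with search {A = λ s → Covered m (λ i → D (s , i , zero))}
                               {B = λ s → Large m (λ i → D (s , i , zero))}
                               (λ s → swap (large-or-covered m _ (λ i → D? (s , i , zero)) s))
    ... | inj₂ L = inj₁ (large-map (λ (s , i) → s , i , zero) (λ { refl → refl }) id (large-× L))
    ... | inj₁ (s , C) = inj₂ (c , agree)
      where
      open Covered C
      heads : Fin (suc m) → Fin N
      heads zero    = s
      heads (suc a) = by a
      c : Fin Codes
      c = combine (funToFin heads) (funToFin {N} (λ _ → combine (combine o o) o))
      head-c : ∀ a → head c a ≡ heads a
      head-c a = trans (cong (λ r → finToFun (proj₁ r) a) (remQuot-combine (funToFin heads) _))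
                       (finToFun-funToFin heads a)
      agree : ∀ {q} → D q → Dom true c q → undecided q ≡ true
      agree {_ , _ , suc _} _ _ = refl
      agree {s′ , i , zero} d (s′≡ , ¬e) with refl ← trans s′≡ (head-c zero) =
        let a , eq = covers d in contradiction (a , trans (head-c (suc a)) eq) ¬e

    corner : Fin N → Fin N × Fin m → Position
    corner s (i , k) = s , i , suc k

    -- A row with all its bits k in `D` is large by itself. Otherwise each row has a bit k outside
    -- `D`, and the 0-certificate choosing these meets `D` only in bits w, which are 0.
    hard-false : (D : Position → Set) → Decidable D →
                 Large (N * m) D ⊎ ∃ λ c → ∀ {q} → D q → Dom false c q → undecided q ≡ false
    hard-false D D? with search {A = λ s → ∀ y → D (corner s y)}
                                {B = λ s → ∃ λ y → ¬ D (corner s y)} all-or-missing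
      where
      all-or-missing : ∀ s → (∀ y → D (corner s y)) ⊎ ∃ λ y → ¬ D (corner s y)
      all-or-missing s with any? (λ i → any? (λ k → ¬? (D? (corner s (i , k)))))
      ... | yes (i , k , ¬d) = inj₂ ((i , k) , ¬d)
      ... | no ¬∃ = inj₁ λ (i , k) → decidable-stable (D? _) λ ¬d → ¬∃ (i , k , ¬d)
    ... | inj₁ (s , h) = inj₁ (large-via *↔× (corner s) (λ { refl → refl }) h)
    ... | inj₂ h = inj₂ (c , agree)
      where
      free : Fin N → Fin (N * m)
      free s = let (i , k) , _ = h s in combine i k
      c : Fin Codes
      c = combine (funToFin {suc m} (λ _ → combine o o)) (funToFin free)
      choice-c : ∀ s → choice c s ≡ proj₁ (h s)
      choice-c s = trans
        (cong (λ r → remQuot {N} m (finToFun (proj₂ r) s))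
              (remQuot-combine (funToFin {suc m} (λ _ → combine o o)) (funToFin free)))
        (trans (cong (remQuot {N} m) (finToFun-funToFin free s)) (remQuot-combine {N} _ _))
      agree : ∀ {q} → D q → Dom false c q → undecided q ≡ false
      agree {_ , _ , zero} _ _ = refl
      agree {s , i , suc k} d (refl , refl) =
        contradiction (subst (λ y → D (corner s y)) (choice-c s) d) (proj₂ (h s))

  partialFunction : PartialFunction Codes (N + N) (N * m)
  partialFunction = record
    { finite    = finite-Fin N ×-finite (finite-Fin N ×-finite finite-Fin (suc m))
    ; Dom       = Dom
    ; Dom?      = Dom?
    ; meet      = meet
    ; covered   = covered
    ; undecided = undecided
    ; hard      = λ { false → hard-false ; true → hard-true }
    }

-- Unambiguous DNFs from cheat sheets.

bit : ∀ {n} → Fin (2 ^ n) → Fin n → Bool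
bit z i = Inverse.to 2↔Bool (finToFun z i)

finToFun-injective : ∀ {n k} {z z′ : Fin (k ^ n)} →
                     (∀ i → finToFun {k} {n} z i ≡ finToFun z′ i) → z ≡ z′
finToFun-injective {n} {k} {z} {z′} eq =
  trans (sym (funToFin-finToFin {n} {k} z)) (trans (funToFin-cong eq) (funToFin-finToFin {n} {k} z′))
  where
  funToFin-cong : ∀ {n k} {f g : Fin n → Fin k} → (∀ i → f i ≡ g i) → funToFin f ≡ funToFin g
  funToFin-cong {zero}  eq = refl
  funToFin-cong {suc n} eq = cong₂ combine (eq zero) (funToFin-cong (eq ∘ suc))

bit-injective : ∀ {n} {z z′ : Fin (2 ^ n)} → (∀ i → bit z i ≡ bit z′ i) → z ≡ z′
bit-injective {n} eq = finToFun-injective {n} {2} (↔-injective 2↔Bool ∘ eq)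

-- At least K bits of the input blank are needed to refute all terms.
record UnambiguousDNF (k K : ℕ) : Set₁ where
  field
    {Var}    : Set
    finite   : Finite Var
    {terms}  : ℕ
    Dom      : Fin terms → Var → Set
    Dom?     : ∀ τ → Decidable (Dom τ)
    val      : Fin terms → Var → Bool

  infix 4 _⊑_
  _⊑_ : Fin terms → (Var → Bool) → Set
  τ ⊑ x = ∀ p → Dom τ p → x p ≡ val τ p

  field
    unambiguous : ∀ {τ τ′ x} → τ ⊑ x → τ′ ⊑ x → τ ≡ τ′
    covered     : ∀ τ → Covered k (Dom τ)
    nonempty    : ∀ τ → ∃ (Dom τ)
    blank       : Var → Bool
    rejected    : ∀ τ → ¬ τ ⊑ blank
    hard        : (D : Var → Set) → Decidable D →
                  Large K D ⊎ ∃ λ τ → ∀ {p} → D p → Dom τ p → blank p ≡ val τ p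

-- The empty set is not large, so `hard` must answer with a term.
someTerm : ∀ {k K} (U : UnambiguousDNF k K) → 1 ≤ K → Fin (UnambiguousDNF.terms U)
someTerm U 1≤K with UnambiguousDNF.hard U (λ _ → ⊥) (λ _ → no λ ())
... | inj₁ L       = ⊥-elim (Large.inside L (fromℕ< 1≤K))
... | inj₂ (τ , _) = τ

-- The cheat sheet construction of Aaronson, Ben-David and Kothari: the values
-- of ℓ copies of a partial function address one of 2 ^ ℓ cells, which must
-- contain the codes of certificates for these values.  Bit zero of a cell
-- marks it as filled, so that blank cells are rejected.
module CheatSheet {d B K : ℕ} (G : PartialFunction (2 ^ d) B K) (ℓ : ℕ) (K≤ : K ≤ 2 ^ ℓ) where

  private
    module G = PartialFunction G

    Term = Fin (2 ^ ℓ * (2 ^ d) ^ ℓ)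

    Var = (Fin ℓ × G.Pos) ⊎ (Fin (2 ^ ℓ) × Fin (suc (ℓ * d)))

    address : Term → Fin (2 ^ ℓ)
    address = quotient {2 ^ ℓ} ((2 ^ d) ^ ℓ)

    code : Term → Fin ℓ → Fin (2 ^ d)
    code τ = finToFun (remainder {2 ^ ℓ} ((2 ^ d) ^ ℓ) τ)

    term : Fin (2 ^ ℓ) → (Fin ℓ → Fin (2 ^ d)) → Term
    term z w = combine z (funToFin w)

    address-term : ∀ z w → address (term z w) ≡ z
    address-term z w = cong proj₁ (remQuot-combine z (funToFin w))

    code-term : ∀ z w i → code (term z w) i ≡ w i
    code-term z w i = trans
      (cong (λ r → finToFun (proj₂ r) i) (remQuot-combine z (funToFin w))) (finToFun-funToFin w i)

    term-injective : ∀ {τ τ′} → address τ ≡ address τ′ → (∀ i → code τ i ≡ code τ′ i) → τ ≡ τ′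
    term-injective {τ} {τ′} a≡ c≡ = trans (sym (combine-remQuot {2 ^ ℓ} ((2 ^ d) ^ ℓ) τ))
      (trans (cong₂ combine a≡ (finToFun-injective {ℓ} {2 ^ d} c≡))
             (combine-remQuot {2 ^ ℓ} ((2 ^ d) ^ ℓ) τ′))

    Dom : Term → Var → Set
    Dom τ (inj₁ (i , q)) = G.Dom (bit (address τ) i) (code τ i) q
    Dom τ (inj₂ (z , _)) = z ≡ address τ

    Dom? : ∀ τ → Decidable (Dom τ)
    Dom? τ (inj₁ (i , q)) = G.Dom? _ _ q
    Dom? τ (inj₂ (z , _)) = z ≟ _

    codeBit : (Fin ℓ → Fin (2 ^ d)) → Fin ℓ × Fin d → Bool
    codeBit w (i , j) = bit (w i) j

    val : Term → Var → Bool
    val τ (inj₁ (i , q))     = bit (address τ) i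
    val τ (inj₂ (_ , zero))  = true
    val τ (inj₂ (_ , suc e)) = codeBit (code τ) (remQuot {ℓ} d e)

    _⊑_ : Term → (Var → Bool) → Set
    τ ⊑ x = ∀ p → Dom τ p → x p ≡ val τ p

    -- The certified values of the copies fix the address. Both terms then read the same cell, and
    -- its content fixes the codes.
    unambiguous : ∀ {τ τ′ x} → τ ⊑ x → τ′ ⊑ x → τ ≡ τ′
    unambiguous {τ} {τ′} {x} h h′ = term-injective address≡ λ i → bit-injective (λ j →
      subst (λ r → codeBit (code τ) r ≡ codeBit (code τ′) r) (remQuot-combine {ℓ} i j)
        (trans (sym (h (inj₂ (_ , suc (combine i j))) refl)) (h′ _ address≡)))
      where
      address≡ : address τ ≡ address τ′
      address≡ = bit-injective λ i →
        G.same-value (h (inj₁ (i , _))) (h′ (inj₁ (i , _)))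

    covered : ∀ τ → Covered (suc (ℓ * d) + ℓ * B) (Dom τ)
    covered τ = covered-via (↔-trans +↔⊎ (↔-refl ⊎-↔ *↔×)) f f-covers
      where
      certificate : ∀ i → Covered B (G.Dom (bit (address τ) i) (code τ i))
      certificate i = G.covered _ _
      f : Fin (suc (ℓ * d)) ⊎ (Fin ℓ × Fin B) → Var
      f (inj₁ e)       = inj₂ (address τ , e)
      f (inj₂ (i , j)) = inj₁ (i , Covered.by (certificate i) j)
      f-covers : ∀ {p} → Dom τ p → ∃ λ y → f y ≡ p
      f-covers {inj₁ (i , q)} d = let j , eq = Covered.covers (certificate i) d in
        inj₂ (i , j) , cong (λ q → inj₁ (i , q)) eq
      f-covers {inj₂ (_ , e)} refl = inj₁ e , refl

    blank : Var → Bool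
    blank (inj₁ (i , q)) = G.undecided q
    blank (inj₂ _)       = false

    -- Touching every cell costs 2 ^ ℓ. Otherwise some cell `z` is untouched, and `G.hard` is
    -- applied to each copy with the value that `z` prescribes: either one copy is expensive, or the
    -- certificates obtained, with their codes written into `z`, form a term compatible with `blank`
    -- on `D`.
    hard : (D : Var → Set) → Decidable D →
           Large K D ⊎ ∃ λ τ → ∀ {p} → D p → Dom τ p → blank p ≡ val τ p
    hard D D? with search {A = λ z → ∀ e → ¬ D (inj₂ (z , e))}
                          {B = λ z → ∃ λ e → D (inj₂ (z , e))} untouched-or-touched
      where
      untouched-or-touched : ∀ z → (∀ e → ¬ D (inj₂ (z , e))) ⊎ ∃ λ e → D (inj₂ (z , e))
      untouched-or-touched z with any? (λ e → D? (inj₂ (z , e)))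
      ... | yes ∃d = inj₂ ∃d
      ... | no ¬∃d = inj₁ λ e d → ¬∃d (e , d)
    ... | inj₂ h = inj₁ (large-≤ K≤
            (large-via ↔-refl (λ z → inj₂ (z , proj₁ (h z))) (λ { refl → refl }) (proj₂ ∘ h)))
    ... | inj₁ (z , free) with search (λ i → G.hard (bit z i) (λ q → D (inj₁ (i , q))) (λ q → D? _))
    ... | inj₁ (i , L) = inj₁ (large-map (λ q → inj₁ (i , q)) (λ { refl → refl }) id L)
    ... | inj₂ h = inj₂ (term z w , agree)
      where
      w : Fin ℓ → Fin (2 ^ d)
      w i = proj₁ (h i)
      agree : ∀ {p} → D p → Dom (term z w) p → blank p ≡ val (term z w) p
      agree {inj₁ (i , q)} d e rewrite address-term z w | code-term z w i = proj₂ (h i) d e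
      agree {inj₂ (_ , e)} d refl = contradiction
        (subst (λ z → D (inj₂ (z , e))) (address-term z w) d) (free e)

  dnf : UnambiguousDNF (suc (ℓ * d) + ℓ * B) K
  dnf = record
    { finite      = (finite-Fin ℓ ×-finite G.finite) ⊎-finite
                    (finite-Fin (2 ^ ℓ) ×-finite finite-Fin _)
    ; Dom         = Dom
    ; Dom?        = Dom?
    ; val         = val
    ; unambiguous = unambiguous
    ; covered     = covered
    ; nonempty    = λ τ → inj₂ (address τ , zero) , refl
    ; blank       = blank
    ; rejected    = λ τ h → contradiction (h (inj₂ (address τ , zero)) refl) λ ()
    ; hard        = hard
    }

-- Partial assignments, and the OR of desensitised blocks.

other : Fin 2 → Fin 2
other zero       = suc zero
other (suc zero) = zero

other-≢ : ∀ c → other c ≢ c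
other-≢ zero       ()
other-≢ (suc zero) ()

other-elim : (Q : Fin 2 → Set) → ∀ {c} → Q c → Q (other c) → ∀ c′ → Q c′
other-elim Q {zero}     q r zero       = q
other-elim Q {zero}     q r (suc zero) = r
other-elim Q {suc zero} q r zero       = r
other-elim Q {suc zero} q r (suc zero) = q

consistent-agree : ∀ {n} {q : PartialAssignment n} {x y} → Consistent q x →
                   (∀ i → Is-just (lookup q i) → lookup x i ≡ lookup y i) → Consistent q y
consistent-agree {y = []} [] eq = []
consistent-agree {y = _ ∷ _} (MaybeAll.nothing ∷ cs) eq =
  MaybeAll.nothing ∷ consistent-agree cs (eq ∘ suc)
consistent-agree {y = _ ∷ _} (MaybeAll.just m≡ ∷ cs) eq =
  MaybeAll.just (trans m≡ (eq zero (MaybeAny.just tt))) ∷ consistent-agree cs (eq ∘ suc)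

total-consistent : ∀ {n} (x : Vec Bool n) → Consistent (Vec.map just x) x
total-consistent []      = []
total-consistent (_ ∷ x) = MaybeAll.just refl ∷ total-consistent x

total-unique : ∀ {n} (x : Vec Bool n) {y} → Consistent (Vec.map just x) y → x ≡ y
total-unique []      []                         = refl
total-unique (b ∷ x) (MaybeAll.just refl ∷ cs) = cong (b ∷_) (total-unique x cs)

total-certificate : ∀ {n} (f : BoolFun n) x → IsCertificate f x (Vec.map just x)
total-certificate f x = total-consistent x , λ y z cy cz →
  cong f (trans (sym (total-unique x cy)) (total-unique x cz))

-- Desensitisation: a block consists of two inputs of the DNF and is accepted
-- if both satisfy the same term, so that it has at most one sensitive bit per
-- input when it is rejected.
module Desensitised {k K : ℕ} (U : UnambiguousDNF k K) (T : ℕ) where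

  open UnambiguousDNF U

  private
    abstract
      position : Finite (Fin T × Fin 2 × Var)
      position = finite-Fin T ×-finite (finite-Fin 2 ×-finite finite)

    module Position = Finite position
    open Position using
      (index; element; element-index; index-element; index-injective; element-injective; _≟ᶠ_)

  n : ℕ
  n = Position.card

  private
    Point = Fin T × Fin 2 × Var

    Input = Point → Bool

    read : Vec Bool n → Input
    read x = lookup x ∘ index

    write : Input → Vec Bool n
    write X = tabulate (X ∘ element)

    read-write : ∀ X p → read (write X) p ≡ X p
    read-write X p = trans (lookup∘tabulate (X ∘ element) (index p)) (cong X (element-index p))

    read-flip : ∀ x i → read (flip x i) (element i) ≡ not (read x (element i))
    read-flip x i rewrite index-element i = lookup∘updateAt i x

    read-flip-≢ : ∀ x i {p} → p ≢ element i → read (flip x i) p ≡ read x p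
    read-flip-≢ x i {p} p≢ = lookup∘updateAt′ (index p) i
      (λ eq → p≢ (trans (sym (element-index p)) (cong element eq))) x

    block : Input → Fin T → Fin 2 → Var → Bool
    block X a c p = X (a , c , p)

    Accepts : Input → Set
    Accepts X = ∃ λ a → ∃ λ τ → ∀ c → τ ⊑ block X a c

    abstract
      accepts? : ∀ X → Dec (Accepts X)
      accepts? X = any? λ a → any? λ τ → all? λ c →
        Finite.∀? finite λ p → Dom? τ p →-dec (_ ≟ᵇ _)

    ⊑-resp : ∀ {τ x y} → (∀ {p} → Dom τ p → x p ≡ y p) → τ ⊑ x → τ ⊑ y
    ⊑-resp eq h p d = trans (sym (eq d)) (h p d)

    accepts-resp : ∀ {X Y : Input} → (∀ p → X p ≡ Y p) → Accepts X → Accepts Y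
    accepts-resp eq (a , τ , h) = a , τ , λ c → ⊑-resp (λ _ → eq _) (h c)

  f : BoolFun n
  f x = does (accepts? (read x))

  -- Upper bound on the sensitivity.

  private
    f-accepts : ∀ x → Accepts (read x) → f x ≡ true
    f-accepts x = dec-true (accepts? (read x))

    f-rejects : ∀ x → ¬ Accepts (read x) → f x ≡ false
    f-rejects x = dec-false (accepts? (read x))

    Sensitive : Vec Bool n → Fin n → Set
    Sensitive x i = f (flip x i) ≢ f x

    sensitive-large : ∀ x → Large (sensitivityAt f x) (Sensitive x)
    sensitive-large x = large-map id id
      (λ {i} → subst (Sensitive x) (lookup-allFin i))
      (count-large (λ i → ¬? (f (flip x i) ≟ᵇ f x)) (allFin n))

    sensitivityAt-large : ∀ {M} x → Large M (Sensitive x) → M ≤ sensitivityAt f x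
    sensitivityAt-large x L = large≤covered
      (large-map id id (λ {i} → subst (Sensitive x) (sym (lookup-allFin i))) L)
      (count-covered (λ i → ¬? (f (flip x i) ≟ᵇ f x)) (allFin n))

    -- A flip outside the satisfied term of an accepting block keeps that block accepting, and the
    -- term has at most `k` positions in each of the two copies.
    accepted-bound : ∀ x → Accepts (read x) → sensitivityAt f x ≤ 2 * k
    accepted-bound x (a , τ , h) = large≤covered (sensitive-large x) (covered-via *↔× g g-covers)
      where
      open Covered (covered τ)
      g : Fin 2 × Fin k → Fin n
      g (c , j) = index (a , c , by j)
      g-covers : ∀ {i} → Sensitive x i → ∃ λ y → g y ≡ i
      g-covers {i} s with element i in eq
      ... | a′ , c , p with a′ ≟ a ×-dec Dom? τ p
      ... | yes (refl , d) = let j , by≡ = covers d in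
              (c , j) , trans (cong (λ p → index (a , c , p)) by≡)
                              (trans (cong index (sym eq)) (index-element i))
      ... | no ¬d = contradiction
        (trans (f-accepts (flip x i) still) (sym (f-accepts x (a , τ , h)))) s
        where
        still : Accepts (read (flip x i))
        still = a , τ , λ c′ → ⊑-resp (λ d → sym (read-flip-≢ x i λ eq′ →
          case-≡ (trans eq′ eq) d)) (h c′)
          where
          case-≡ : ∀ {c′ p′} → (a , c′ , p′) ≡ (a′ , c , p) → ¬ Dom τ p′
          case-≡ refl d = ¬d (refl , d)

    sensitive-accepts : ∀ x {i} → ¬ Accepts (read x) → Sensitive x i → Accepts (read (flip x i))
    sensitive-accepts x ¬A s = decidable-stable (accepts? _) λ ¬A′ →
      s (trans (f-rejects (flip x _) ¬A′) (sym (f-rejects x ¬A)))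

    site : Fin n → Fin T × Fin 2
    site i = let a , c , _ = element i in a , c

    -- The other copy is left unchanged by the flip, hence it determines the
    -- term that is satisfied after the flip.
    repaired : ∀ x {i a c} → ¬ Accepts (read x) → Sensitive x i → site i ≡ (a , c) →
               ∃ λ τ → τ ⊑ block (read x) a (other c) ×
                 (∀ {p} → Dom τ p → (a , c , p) ≢ element i → read x (a , c , p) ≡ val τ p)
    repaired x {i} {a} {c} ¬A s refl with sensitive-accepts x ¬A s
    ... | b , τ , h with b ≟ a
    ... | no b≢a = contradiction
            (b , τ , λ c′ → ⊑-resp (λ _ → read-flip-≢ x i λ eq → b≢a (cong proj₁ eq)) (h c′)) ¬A
    ... | yes refl = τ ,
            ⊑-resp (λ _ → read-flip-≢ x i λ eq → other-≢ c (cong (proj₁ ∘ proj₂) eq)) (h (other c)) ,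
            λ d p≢ → trans (sym (read-flip-≢ x i p≢)) (h c _ d)

    -- Two flips in one copy would each repair the damage of the other.
    site-injective : ∀ x {i j} → ¬ Accepts (read x) →
                     Sensitive x i → Sensitive x j → site i ≡ site j → i ≡ j
    site-injective x {i} {j} ¬A s t site≡ with i ≟ j
    ... | yes i≡j = i≡j
    ... | no  i≢j with repaired x ¬A s refl | repaired x ¬A t (sym site≡)
    ... | τ , h , g | τ′ , h′ , g′ with refl ← unambiguous h h′ =
      contradiction (_ , τ , other-elim (λ c → τ ⊑ block (read x) _ c) satisfied h) ¬A
      where
      satisfied : τ ⊑ block (read x) (proj₁ (site i)) (proj₂ (site i))
      satisfied p d with (proj₁ (site i) , proj₂ (site i) , p) ≟ᶠ element i
      ... | no  p≢i = g d p≢i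
      ... | yes p≡i = g′ d λ p≡j → i≢j (element-injective (trans (sym p≡i) p≡j))

    -- By `site-injective`, a sensitive bit is determined by its block and its copy.
    rejected-bound : ∀ x → ¬ Accepts (read x) → sensitivityAt f x ≤ T * 2
    rejected-bound x ¬A = large-bound (sensitive-large x) (λ {i} _ → Finite.index sites (site i))
      λ s t eq → site-injective x ¬A s t (Finite.index-injective sites eq)
      where sites = finite-Fin T ×-finite finite-Fin 2

    sensitivityAt-bound : ∀ x → Dec (Accepts (read x)) → ∀ {B} → 2 * k ≤ B → T * 2 ≤ B →
                          sensitivityAt f x ≤ B
    sensitivityAt-bound x (yes A) 2k≤B 2T≤B = ≤-trans (accepted-bound x A) 2k≤B
    sensitivityAt-bound x (no ¬A) 2k≤B 2T≤B = ≤-trans (rejected-bound x ¬A) 2T≤B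

  sensitivity-bound : ∀ {B} → 2 * k ≤ B → T * 2 ≤ B → sensitivity f ≤ B
  sensitivity-bound 2k≤B 2T≤B = max≤v⁺ {xs = List.map (sensitivityAt f) (inputs n)} z≤n
    (All.map⁺ (All.tabulate λ {x} _ → sensitivityAt-bound x (accepts? (read x)) 2k≤B 2T≤B))

  -- Lower bound on the sensitivity.

  private
    satisfier : Fin terms → Input
    satisfier τ (a , c , p) = val τ p

    -- In every block both copies follow `τ` except for one wrong bit in the first copy, so each
    -- block is one flip away from acceptance.
    spoil : Fin terms → Input
    spoil τ (a , zero , p)     = if does (p ≟ᵛ proj₁ (nonempty τ)) then not (val τ p) else val τ p
      where open Finite finite renaming (_≟ᶠ_ to _≟ᵛ_)
    spoil τ (a , suc zero , p) = val τ p

    spoilt : ∀ τ a c p → (c , p) ≡ (zero , proj₁ (nonempty τ)) → spoil τ (a , c , p) ≡ not (val τ p)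
    spoilt τ a c p refl rewrite dec-true (Finite._≟ᶠ_ finite p p) refl = refl

    unspoilt : ∀ τ a c p → (c , p) ≢ (zero , proj₁ (nonempty τ)) → spoil τ (a , c , p) ≡ val τ p
    unspoilt τ a zero p p≢
      rewrite dec-false (Finite._≟ᶠ_ finite p (proj₁ (nonempty τ))) (λ eq → p≢ (cong (zero ,_) eq)) = refl
    unspoilt τ a (suc zero) p p≢ = refl

    -- The intact second copy leaves `τ` as the only candidate term, and the first copy violates it.
    spoilt-rejected : ∀ τ → ¬ Accepts (spoil τ)
    spoilt-rejected τ (a , τ′ , h)
      with refl ← unambiguous {x = val τ} (h (suc zero)) (λ _ _ → refl) =
      let p , d = nonempty τ in not-¬ refl (sym (trans (sym (spoilt τ a zero p refl)) (h zero p d)))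

    spoilt-sensitive : ∀ τ a → Sensitive (write (spoil τ)) (index (a , zero , proj₁ (nonempty τ)))
    spoilt-sensitive τ a s = contradiction
      (trans (sym (f-accepts (flip x (index p₀)) accepted)) (trans s (f-rejects x rejected′))) λ ()
      where
      x = write (spoil τ)
      p₀ = a , zero , proj₁ (nonempty τ)
      rejected′ : ¬ Accepts (read x)
      rejected′ = spoilt-rejected τ ∘ accepts-resp (read-write (spoil τ))
      restored : ∀ c p → Dec ((a , c , p) ≡ p₀) → read (flip x (index p₀)) (a , c , p) ≡ val τ p
      restored c p (yes refl) = trans (lookup∘updateAt (index p₀) x)
        (trans (cong not (trans (read-write (spoil τ) p₀) (spoilt τ a c p refl))) (not-involutive _))
      restored c p (no p≢) = trans
        (read-flip-≢ x (index p₀) (λ eq → p≢ (trans eq (element-index p₀))))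
        (trans (read-write (spoil τ) _) (unspoilt τ a c p λ eq → p≢ (cong (a ,_) eq)))
      accepted : Accepts (read (flip x (index p₀)))
      accepted = a , τ , λ c p _ → restored c p (_ ≟ᶠ _)

  sensitivity-≥ : Fin terms → T ≤ sensitivity f
  sensitivity-≥ τ = v≤max⁺ 0 _ (inj₂ (lose
    (∈-map⁺ (sensitivityAt f) (∈-vecs ∈-bits x))
    (sensitivityAt-large x L)))
    where
    x = write (spoil τ)
    L : Large T (Sensitive x)
    L = large-via ↔-refl (λ a → index (a , zero , proj₁ (nonempty τ)))
          (cong proj₁ ∘ index-injective) (spoilt-sensitive τ)

  nonConstant : Fin terms → Fin T → NonConstant f
  nonConstant τ a = flip (write (spoil τ)) _ , write (spoil τ) , spoilt-sensitive τ a

  -- Lower bound on the certificate complexity.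

  private
    blanks : Input
    blanks (a , c , p) = blank p

    Fixed : PartialAssignment n → Point → Set
    Fixed q p = Is-just (lookup q (index p))

    fixed? : ∀ q → Decidable (Fixed q)
    fixed? q p = MaybeAny.dec (λ _ → yes tt) _

    module _ (q : PartialAssignment n) (q-cert : IsCertificate f (write blanks) q) where

      -- Either copy counts, because the same term will be written into both.
      Touched : Fin T → Var → Set
      Touched a p = ∃ λ c → Fixed q (a , c , p)

      -- If `hard` answers with a term for some block, writing it into both copies gives an accepted
      -- input consistent with `q`, although `q` certifies the rejected blank input. Hence every
      -- block has `K` touched variables.
      many : Large (T * K) (λ i → Is-just (lookup q i))
      many with search {A = λ a → ∃ λ τ → ∀ {p} → Touched a p → Dom τ p → blank p ≡ val τ p}
                       {B = λ a → Large K (Touched a)}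
                       (λ a → swap (hard (Touched a) λ p → any? λ c → fixed? q (a , c , p)))
      ... | inj₂ L = record
        { at        = λ k → let (a , p) , c , _ = touched k in index (a , c , p)
        -- The copy depends on the proof of touching; the block and the variable alone already tell
        -- the positions apart.
        ; injective = λ eq → injective (cong (λ (a , _ , p) → a , p) (index-injective eq))
        ; inside    = λ k → proj₂ (proj₂ (touched k))
        }
        where
        open Large (large-× L)
        touched : Fin (T * K) → ∃ λ ((a , p) : Fin T × Var) → Touched a p
        touched k = at k , inside k
      ... | inj₁ (a , τ , agree) = contradiction
        (trans (sym (f-rejects (write blanks) rejected′))
          (trans (proj₂ q-cert _ _ (proj₁ q-cert) consistent)
                 (f-accepts (write override) accepted))) λ ()
        where
        overridden? : ∀ b p → Dec (b ≡ a × Dom τ p)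
        overridden? b p = b ≟ a ×-dec Dom? τ p
        overrideAt : ∀ b p → Dec (b ≡ a × Dom τ p) → Bool
        overrideAt b p (yes _) = val τ p
        overrideAt b p (no _)  = blank p
        override : Input
        override (b , c , p) = overrideAt b p (overridden? b p)
        overridden : ∀ p → Dom τ p → (d? : Dec (a ≡ a × Dom τ p)) → overrideAt a p d? ≡ val τ p
        overridden p d (yes _) = refl
        overridden p d (no ¬d) = contradiction (refl , d) ¬d
        preserved : ∀ b p → Touched b p → (d? : Dec (b ≡ a × Dom τ p)) → blank p ≡ overrideAt b p d?
        preserved b p t (yes (refl , d)) = agree t d
        preserved b p t (no _)           = refl
        rejected′ : ¬ Accepts (read (write blanks))
        rejected′ A = let b , σ , h = accepts-resp {Y = blanks} (read-write blanks) A in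
          rejected σ (h zero)
        accepted : Accepts (read (write override))
        accepted = a , τ , λ c p d → trans (read-write override _) (overridden p d (overridden? a p))
        unchanged : ∀ i → Is-just (lookup q i) → lookup (write blanks) i ≡ lookup (write override) i
        unchanged i j = let b , c , p = element i in trans (lookup∘tabulate _ i) (trans
          (preserved b p (c , subst (λ i → Is-just (lookup q i)) (sym (index-element i)) j)
                     (overridden? b p))
          (sym (lookup∘tabulate _ i)))
        consistent : Consistent q (write override)
        consistent = consistent-agree (proj₁ q-cert) unchanged

  certificateComplexity-≥ : T * K ≤ certificateComplexity f
  certificateComplexity-≥ = v≤max⁺ 0 _ (inj₂ (lose
    (∈-map⁺ (certificateComplexityAt f) (∈-vecs ∈-bits x))
    -- The starting value of the minimum also obeys the bound, as it is at least the size of the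
    -- total certificate.
    (v≤min⁺ (≤-trans (size-≥ _ (total-certificate f x)) (count≤n _ (Vec.map just x)))
            (All.map⁺ (All.map (size-≥ _)
                                (All.all-filter (isCertificate? f x) (partialAssignments n)))))))
    where
    x = write blanks
    size-≥ : ∀ q → IsCertificate f x q → T * K ≤ size q
    size-≥ q q-cert = large≤covered (many q q-cert) (count-covered _ q)

-- From rational inequalities to natural numbers.

fromℕ-* : ∀ m n → fromℕ (m * n) ≡ fromℕ m ℚ.* fromℕ n
fromℕ-* m n = ℚ.toℚᵘ-injective (begin
  ℚ.toℚᵘ (fromℕ (m * n))                     ≈⟨ ℚ.toℚᵘ-fromℚᵘ _ ⟩
  mkℚᵘ (+ (m * n)) 0                         ≈⟨ *≡* (cong (ℤ._* + 1) (ℤ.pos-* m n)) ⟩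
  mkℚᵘ (+ m) 0 ℚᵘ.* mkℚᵘ (+ n) 0
    ≈⟨ ℚᵘ.*-cong (ℚ.toℚᵘ-fromℚᵘ (mkℚᵘ (+ m) 0)) (ℚ.toℚᵘ-fromℚᵘ (mkℚᵘ (+ n) 0)) ⟨
  ℚ.toℚᵘ (fromℕ m) ℚᵘ.* ℚ.toℚᵘ (fromℕ n)     ≈⟨ ℚ.toℚᵘ-homo-* (fromℕ m) (fromℕ n) ⟨
  ℚ.toℚᵘ (fromℕ m ℚ.* fromℕ n)               ∎)
  where open SetoidReasoning ℚᵘ.≃-setoid

fromℕ-mono : ∀ {m n} → m ≤ n → fromℕ m ℚ.≤ fromℕ n
fromℕ-mono {m} {n} m≤n = ℚ.toℚᵘ-cancel-≤ (begin
  ℚ.toℚᵘ (fromℕ m)  ≃⟨ ℚ.toℚᵘ-fromℚᵘ (mkℚᵘ (+ m) 0) ⟩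
  mkℚᵘ (+ m) 0      ≤⟨ *≤* (ℤ.*-monoʳ-≤-nonNeg (+ 1) (ℤ.+≤+ m≤n)) ⟩
  mkℚᵘ (+ n) 0      ≃⟨ ℚ.toℚᵘ-fromℚᵘ (mkℚᵘ (+ n) 0) ⟨
  ℚ.toℚᵘ (fromℕ n)  ∎)
  where open ℚᵘ.≤-Reasoning

pow-inverse : ∀ r c q → r ℚ.* fromℕ c ≡ 1ℚ → pow +-*-rawSemiring r q ℚ.* fromℕ (c ^ q) ≡ 1ℚ
pow-inverse r c zero    rc≡1 = refl
pow-inverse r c (suc q) rc≡1 = begin
  (r ℚ.* R) ℚ.* fromℕ (c * c ^ q)             ≡⟨ cong ((r ℚ.* R) ℚ.*_) (fromℕ-* c (c ^ q)) ⟩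
  (r ℚ.* R) ℚ.* (fromℕ c ℚ.* fromℕ (c ^ q))   ≡⟨ interchange *-commutativeSemigroup r R _ _ ⟩
  (r ℚ.* fromℕ c) ℚ.* (R ℚ.* fromℕ (c ^ q))   ≡⟨ cong₂ ℚ._*_ rc≡1 (pow-inverse r c q rc≡1) ⟩
  1ℚ                                          ∎
  where
  open ≡-Reasoning
  open CommutativeMonoid ℚ.*-1-commutativeMonoid
    using () renaming (commutativeSemigroup to *-commutativeSemigroup)
  R = pow +-*-rawSemiring r q

pow-positive : ∀ r .{{_ : ℚ.Positive r}} q → ℚ.Positive (pow +-*-rawSemiring r q)
pow-positive r zero    = _
pow-positive r (suc q) = ℚ.pos*pos⇒pos r _ {{pow-positive r q}}

-- With `r` the inverse of `c`, multiplying by the q-th power of `r` turns an inequality of natural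
-- numbers into the rational one.
clear-denominator : ∀ {a b} r .{{_ : ℚ.Positive r}} c p q .{{_ : NonZero q}} → r ℚ.* fromℕ c ≡ 1ℚ →
                    b ^ p ≤ c ^ q * a ^ q → a ≥ r · b ^[ p / q ]
clear-denominator {a} {b} r c p q rc≡1 b≤ = begin
  R ℚ.* fromℕ (b ^ p)
    ≤⟨ ℚ.*-monoˡ-≤-nonNeg R {{ℚ.pos⇒nonNeg R {{pow-positive r q}}}} (fromℕ-mono b≤) ⟩
  R ℚ.* fromℕ (c ^ q * a ^ q)              ≡⟨ cong (R ℚ.*_) (fromℕ-* (c ^ q) (a ^ q)) ⟩
  R ℚ.* (fromℕ (c ^ q) ℚ.* fromℕ (a ^ q))  ≡⟨ ℚ.*-assoc R (fromℕ (c ^ q)) (fromℕ (a ^ q)) ⟨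
  R ℚ.* fromℕ (c ^ q) ℚ.* fromℕ (a ^ q)    ≡⟨ cong (ℚ._* fromℕ (a ^ q)) (pow-inverse r c q rc≡1) ⟩
  1ℚ ℚ.* fromℕ (a ^ q)                     ≡⟨ ℚ.*-identityˡ _ ⟩
  fromℕ (a ^ q)                            ∎
  where
  open ℚ.≤-Reasoning
  R = pow +-*-rawSemiring r q

-- Numerical estimates and the exponent 2.22.

-- The left side is the width of the cheat sheet DNF for ℓ = 18u. The total 793 is rounded up to a
-- power of two.
width-bound : ∀ {u U m N} → u ≤ U → 1 ≤ U → 1 ≤ N → m ≤ N →
  suc (18 * u * (12 * u * suc m + 18 * u * N)) + 18 * u * (N + N) ≤ 1024 * (U * U * N)
width-bound {u} {U} {m} {N} u≤U 1≤U 1≤N m≤N = begin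
  suc (18 * u * (12 * u * suc m + 18 * u * N)) + 18 * u * (N + N)
    ≤⟨ +-mono-≤ (+-mono-≤ (*-mono-≤ (*-mono-≤ 1≤U 1≤U) 1≤N)
         (*-mono-≤ 18u≤ (+-mono-≤ (*-mono-≤ (*-monoʳ-≤ 12 u≤U) (+-mono-≤ 1≤N m≤N)) (*-monoˡ-≤ N 18u≤))))
         (*-mono-≤ (≤-trans 18u≤ (m≤m*n (18 * U) U {{>-nonZero 1≤U}})) (≤-refl {N + N})) ⟩
  U * U * N + 18 * U * (12 * U * (N + N) + 18 * U * N) + 18 * U * U * (N + N)
    ≡⟨ lemma U N ⟩
  793 * (U * U * N)
    ≤⟨ *-monoˡ-≤ (U * U * N) (m≤m+n 793 231) ⟩
  1024 * (U * U * N) ∎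
  where
  open ≤-Reasoning
  18u≤ : 18 * u ≤ 18 * U
  18u≤ = *-monoʳ-≤ 18 u≤U
  lemma : ∀ U N → U * U * N + 18 * U * (12 * U * (N + N) + 18 * U * N) + 18 * U * U * (N + N)
          ≡ 793 * (U * U * N)
  lemma = solve-∀

n≤2^n : ∀ n → n ≤ 2 ^ n
n≤2^n zero    = z≤n
n≤2^n (suc n) = +-mono-≤ (m^n>0 2 n) (≤-trans (n≤2^n n) (m≤m+n (2 ^ n) 0))

-- Bounding both measures by powers of two leaves a linear inequality between exponents.
^-separation : ∀ p q {c t κ s C} → (1 + t) * p ≤ c * q + (t + κ) * q →
               s ≤ 2 * 2 ^ t → 2 ^ t * 2 ^ κ ≤ C → s ^ p ≤ (2 ^ c) ^ q * C ^ q
^-separation p q {c} {t} {κ} {s} {C} exponents s≤ C≥ = begin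
  s ^ p                                  ≤⟨ ^-monoˡ-≤ p s≤ ⟩
  (2 ^ (1 + t)) ^ p                      ≡⟨ ^-*-assoc 2 (1 + t) p ⟩
  2 ^ ((1 + t) * p)                      ≤⟨ ^-monoʳ-≤ 2 exponents ⟩
  2 ^ (c * q + (t + κ) * q)              ≡⟨ ^-distribˡ-+-* 2 (c * q) ((t + κ) * q) ⟩
  2 ^ (c * q) * 2 ^ ((t + κ) * q)        ≡⟨ cong₂ _*_ (^-*-assoc 2 c q) (^-*-assoc 2 (t + κ) q) ⟨
  (2 ^ c) ^ q * (2 ^ (t + κ)) ^ q        ≡⟨ cong (λ x → (2 ^ c) ^ q * x ^ q) (^-distribˡ-+-* 2 t κ) ⟩
  (2 ^ c) ^ q * (2 ^ t * 2 ^ κ) ^ q      ≤⟨ *-monoʳ-≤ ((2 ^ c) ^ q) (^-monoˡ-≤ q C≥) ⟩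
  (2 ^ c) ^ q * C ^ q                    ∎
  where open ≤-Reasoning

-- Per unit of u this compares 14 · 111 = 1554 with 32 · 50 = 1600: the bounds give the exponent
-- 32/14, about 2.28, where 5/2 is lowered by the estimate u² ≤ 4^u. The 15, from the constant
-- 1/2^15, absorbs the additive terms.
exponents-≤ : ∀ u → (1 + (10 + 14 * u)) * 111 ≤ 15 * 50 + (10 + 14 * u + 18 * u) * 50
exponents-≤ u = ≤-trans (m≤m+n _ (29 + 46 * u)) (≤-reflexive (lemma u))
  where
  lemma : ∀ u → (1 + (10 + 14 * u)) * 111 + (29 + 46 * u) ≡ 15 * 50 + (10 + 14 * u + 18 * u) * 50
  lemma = solve-∀

separates : ∀ u {s C} → s ≤ 2 * 2 ^ (10 + 14 * u) → 2 ^ (10 + 14 * u) * 2 ^ (18 * u) ≤ C →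
            C ≥ + 1 ℚ./ 32768 · s ^[ 111 / 50 ]
separates u {s} {C} s≤ C≥ = clear-denominator {C} {s} (+ 1 ℚ./ 32768) (2 ^ 15) 111 50 refl
  (^-separation 111 50 {15} {10 + 14 * u} {18 * u} {s} {C} (exponents-≤ u) s≤ C≥)

omegaFamily : (n : ℕ → ℕ) (f : ∀ u → BoolFun (n u)) → (∀ u → NonConstant (f u)) →
              (∀ u → u ≤ sensitivity (f u)) →
              (∀ u → sensitivity (f u) ≤ 2 * 2 ^ (10 + 14 * u)) →
              (∀ u → 2 ^ (10 + 14 * u) * 2 ^ (18 * u) ≤ certificateComplexity (f u)) →
              OmegaFamily certificateComplexity sensitivity 111 50
omegaFamily n f nc lo s≤ C≥ = n , f , nc , (λ M → M , λ k M≤k → ≤-trans M≤k (lo k)) ,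
  + 1 ℚ./ 32768 , ℚ.positive⁻¹ _ ,
  λ u → separates u {sensitivity (f u)} {certificateComplexity (f u)} (s≤ u) (C≥ u)

-- The family.

-- With m = 64^u and N = 4096^u the width is O(u² N), and u² ≤ 4^u brings it
-- below T = 2^(10 + 14u), whereas the certificates cost N m = 2^(18u).
module Family (u : ℕ) where

  m = 2 ^ (6 * u)
  N = m * m
  ℓ = 18 * u
  d = 12 * u * suc m + 18 * u * N
  T = 2 ^ (10 + 14 * u)

  N≡ : N ≡ 2 ^ (12 * u)
  N≡ = trans (sym (^-distribˡ-+-* 2 (6 * u) (6 * u))) (cong (2 ^_) (lemma u))
    where
    lemma : ∀ u → 6 * u + 6 * u ≡ 12 * u
    lemma = solve-∀

  N*m≡ : N * m ≡ 2 ^ ℓ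
  N*m≡ = trans (cong (_* m) N≡)
    (trans (sym (^-distribˡ-+-* 2 (12 * u) (6 * u))) (cong (2 ^_) (lemma u)))
    where
    lemma : ∀ u → 12 * u + 6 * u ≡ 18 * u
    lemma = solve-∀

  open Base m (fromℕ< (m^n>0 2 (6 * u))) hiding (N)

  -- Since m and N are powers of two, every word of d bits is a code.
  Codes≡ : Codes ≡ 2 ^ d
  Codes≡ = begin
    N ^ suc m * (N * m) ^ N
      ≡⟨ cong₂ (λ x y → x ^ suc m * y ^ N) N≡ N*m≡ ⟩
    (2 ^ (12 * u)) ^ suc m * (2 ^ (18 * u)) ^ N
      ≡⟨ cong₂ _*_ (^-*-assoc 2 (12 * u) (suc m)) (^-*-assoc 2 (18 * u) N) ⟩
    2 ^ (12 * u * suc m) * 2 ^ (18 * u * N)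
      ≡⟨ ^-distribˡ-+-* 2 (12 * u * suc m) (18 * u * N) ⟨
    2 ^ d ∎
    where open ≡-Reasoning

  dnf : UnambiguousDNF (suc (ℓ * d) + ℓ * (N + N)) (2 ^ ℓ)
  -- Since 2 ^ ℓ is N m, touching all cells costs exactly as much as the hardness of a single copy,
  -- which is why `≤-refl` suffices.
  dnf = CheatSheet.dnf
    (subst₂ (λ M K → PartialFunction M (N + N) K) Codes≡ N*m≡ partialFunction) ℓ ≤-refl

  -- Keeps twice the width, the sensitivity bound on accepted inputs, within 2 T, the bound on
  -- rejected ones.
  width≤T : suc (ℓ * d) + ℓ * (N + N) ≤ T
  width≤T = begin
    suc (ℓ * d) + ℓ * (N + N)
      ≤⟨ width-bound {u} {2 ^ u} {m} {N} (n≤2^n u) (m^n>0 2 u)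
           (*-mono-≤ 1≤m 1≤m) (m≤m*n m m {{>-nonZero 1≤m}}) ⟩
    2 ^ 10 * (2 ^ u * 2 ^ u * N)
      ≡⟨ cong (2 ^ 10 *_) (cong₂ _*_ (sym (^-distribˡ-+-* 2 u u)) N≡) ⟩
    2 ^ 10 * (2 ^ (u + u) * 2 ^ (12 * u))
      ≡⟨ cong (2 ^ 10 *_) (^-distribˡ-+-* 2 (u + u) (12 * u)) ⟨
    2 ^ 10 * 2 ^ (u + u + 12 * u)
      ≡⟨ ^-distribˡ-+-* 2 10 (u + u + 12 * u) ⟨
    2 ^ (10 + (u + u + 12 * u))
      ≡⟨ cong (λ e → 2 ^ (10 + e)) (lemma u) ⟩
    T ∎
    where
    open ≤-Reasoning
    1≤m : 1 ≤ m
    1≤m = m^n>0 2 (6 * u)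
    lemma : ∀ u → u + u + 12 * u ≡ 14 * u
    lemma = solve-∀

  open Desensitised dnf T public

  τ = someTerm dnf (m^n>0 2 ℓ)

  f-nonConstant : NonConstant f
  f-nonConstant = nonConstant τ (fromℕ< (m^n>0 2 (10 + 14 * u)))

  u≤sensitivity : u ≤ sensitivity f
  u≤sensitivity = begin
    u              ≤⟨ n≤2^n u ⟩
    2 ^ u          ≤⟨ ^-monoʳ-≤ 2 (≤-trans (m≤n*m u 14) (m≤n+m (14 * u) 10)) ⟩
    T              ≤⟨ sensitivity-≥ τ ⟩
    sensitivity f  ∎
    where open ≤-Reasoning

  s≤ : sensitivity f ≤ 2 * T
  s≤ = sensitivity-bound (*-monoʳ-≤ 2 width≤T) (≤-reflexive (*-comm T 2))

  C≥ : T * 2 ^ ℓ ≤ certificateComplexity f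
  C≥ = certificateComplexity-≥

corollary4 : OmegaFamily certificateComplexity sensitivity 111 50
corollary4 = omegaFamily
  Family.n Family.f Family.f-nonConstant Family.u≤sensitivity Family.s≤ Family.C≥
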